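{- If $(S,K,I)$ is a split graph, then the factor graph $\Phi(S)$ cannot contain an induced path $v_1v_2v_3v_4$ with $\sigma_{23}=1$.
   Context: A split graph $(S,K,I)$ is a graph $S$ together with a fixed partition $V(S)=K\dot\cup I$, where $K$ is a clique and $I$ is an independent set. For a vertex $v_i$ of $S$, $N_i$ denotes its open neighborhood in $S$ and $d_i=|N_i|$; $\eta_{uv}=|N_u\cap N_v|$. The factor graph $\Phi(S)$ is the loopless multigraph with vertex set $I$ in which, for distinct $u,v\in I$, there is one edge joining $u$ and $v$ for each 2-switch of $S$ acting on $u$ and $v$ (a 2-switch replaces edges $ab,cd$ with $ac,bd$ when $ab,cd\in E(S)$ and $ac,bd\notin E(S)$); equivalently, the multiplicity of $uv$ is $\sigma_{uv}=(d_u-\eta_{uv})(d_v-\eta_{uv})$, and $u,v$ are adjacent iff $\sigma_{uv}>0$; $\sigma_{ij}$ denotes $\sigma_{v_iv_j}$. An induced path in $\Phi(S)$ consists of distinct vertices with consecutive ones adjacent and no other pair adjacent (multiplicities ignored). -}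

module Defs where

open import Data.Bool.Base using (true; false)
open import Data.Fin.Base using (Fin; zero; suc; toℕ)
open import Data.Fin.Properties using (_≟_)
open import Data.Fin.Subset using (Subset; _∈_; _∉_; _∩_; _─_; ∣_∣; inside; outside; ⁅_⁆)
open import Data.Fin.Subset.Properties using (_∈?_; ∩-comm; ∩-idem; x∈p∧x∉q⇒x∈p─q; p─q⊆p; ∣⁅x⁆∣≡1; x∈⁅x⁆; x∈⁅y⁆⇒x≡y)
open import Data.List.Base using (List; []; _∷_; _++_; length; filter; map; allFin; cartesianProduct)
import Data.List.Base as List
open import Data.List.Properties using (filter-++; filter-≐; length-++)
open import Data.List.Relation.Unary.All using ([]; _∷_)
open import Data.List.Relation.Unary.AllPairs using ([]; _∷_)
open import Data.List.Relation.Unary.Any using (here; there)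
open import Data.List.Relation.Unary.Unique.Propositional using (Unique)
import Data.List.Relation.Unary.Unique.DecPropositional as DecUnique
import Data.List.Membership.Propositional as List
import Data.List.Membership.DecPropositional as DecMembership
open import Data.Nat.Base using (ℕ; zero; suc; _+_; _*_; _∸_; _<_)
open import Data.Nat.Properties using (+-suc; m+n∸n≡m; n∸n≡0; *-identityʳ; *-comm; *-distribʳ-+)
open import Data.Product.Base using (∃; _×_; _,_; proj₁; proj₂)
open import Data.Sum.Base using (_⊎_; inj₁; inj₂)
open import Data.Vec.Base using (Vec; []; _∷_; tabulate; lookup; here; there)
open import Data.Vec.Properties using (lookup∘tabulate; []=⇒lookup; lookup⇒[]=)
open import Function.Base using (_∘_)
open import Function.Definitions using (Injective)
open import Level using (Level; 0ℓ)
open import Relation.Binary.Core using (Rel)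
open import Relation.Binary.Definitions using (Symmetric; Decidable)
open import Relation.Binary.PropositionalEquality using (_≡_; _≢_; refl; sym; trans; cong; cong₂; module ≡-Reasoning)
open import Relation.Nullary using (does; yes; no; ¬_; ¬?; contradiction; _×-dec_)
open import Relation.Nullary.Decidable using (dec-true)
import Relation.Unary as U

record Graph (n : ℕ) : Set₁ where
  field
    Adj     : Rel (Fin n) 0ℓ
    adj?    : Decidable Adj
    adj-sym : Symmetric Adj
    irrefl  : ∀ v → ¬ Adj v v

  N : Fin n → Subset n
  N v = tabulate (λ w → does (adj? v w))

  d : Fin n → ℕ
  d v = ∣ N v ∣

  η : Fin n → Fin n → ℕ
  η u v = ∣ N u ∩ N v ∣

  σ : Fin n → Fin n → ℕ
  σ u v = (d u ∸ η u v) * (d v ∸ η u v)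

  -- The quadruple (a , b , c , e) describes the 2-switch replacing the
  -- edges ab, ce with ac, be.  Without uniqueness, ac or be could be a loop.
  IsTwoSwitch : Fin n → Fin n → Fin n → Fin n → Set
  IsTwoSwitch a b c e =
    Unique (a ∷ b ∷ c ∷ e ∷ []) ×
    Adj a b × Adj c e × ¬ Adj a c × ¬ Adj b e

  -- The quadruples (a,b,c,e), (b,a,e,c), (c,e,a,b) and (e,c,b,a) describe
  -- the same 2-switch, and no other quadruple does.  Each of the four
  -- vertices comes first in exactly one of them, so the 2-switches acting
  -- on u and v are the quadruples starting with u and containing v among
  -- the remaining three entries.
  ActsOn : Fin n → Fin n → Fin n × Fin n × Fin n → Set
  ActsOn u v (b , c , e) = IsTwoSwitch u b c e × v List.∈ (b ∷ c ∷ e ∷ [])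

  actsOn? : ∀ u v → U.Decidable (ActsOn u v)
  actsOn? u v (b , c , e) =
    (DecUnique.unique? _≟_ (u ∷ b ∷ c ∷ e ∷ [])
      ×-dec adj? u b ×-dec adj? c e ×-dec ¬? (adj? u c) ×-dec ¬? (adj? b e))
    ×-dec DecMembership._∈?_ _≟_ v (b ∷ c ∷ e ∷ [])

  twoSwitches : Fin n → Fin n → List (Fin n × Fin n × Fin n)
  twoSwitches u v =
    filter (actsOn? u v) (cartesianProduct (allFin n) (cartesianProduct (allFin n) (allFin n)))

record SplitGraph (n : ℕ) : Set₁ where
  field
    graph       : Graph n
    K I         : Subset n
    cover       : ∀ v → v ∈ K ⊎ v ∈ I
    disjoint    : ∀ v → v ∈ K → v ∉ I
  open Graph graph public
  field
    clique      : ∀ {u v} → u ∈ K → v ∈ K → u ≢ v → Adj u v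
    independent : ∀ {u v} → u ∈ I → v ∈ I → ¬ Adj u v

record Multigraph : Set₁ where
  field
    Vertex       : Set
    multiplicity : Vertex → Vertex → ℕ
    mult-sym     : ∀ u v → multiplicity u v ≡ multiplicity v u
    loopless     : ∀ v → multiplicity v v ≡ 0

  Adjacent : Rel Vertex 0ℓ
  Adjacent u v = 0 < multiplicity u v

record IsInducedPath (G : Multigraph) {k : ℕ} (p : Vec (Multigraph.Vertex G) k) : Set where
  open Multigraph G
  field
    distinct    : Injective _≡_ _≡_ (lookup p)
    consecutive : ∀ i j → toℕ j ≡ suc (toℕ i) → Adjacent (lookup p i) (lookup p j)
    chordless   : ∀ i j → suc (toℕ i) < toℕ j → ¬ Adjacent (lookup p i) (lookup p j)

private
  variable
    a b p q : Level
    A : Set a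
    B : Set b
    n : ℕ

filter-map-length : {P : A → Set p} {Q : B → Set q} (P? : U.Decidable P) (Q? : U.Decidable Q)
  (x : A) (ys : List B) →
  length (filter (λ z → P? (proj₁ z) ×-dec Q? (proj₂ z)) (map (x ,_) ys))
    ≡ length (filter P? (x ∷ [])) * length (filter Q? ys)
filter-map-length P? Q? x [] with does (P? x)
... | true  = refl
... | false = refl
filter-map-length P? Q? x (y ∷ ys)
  with does (P? x) | does (Q? y) | filter-map-length P? Q? x ys
... | true  | true  | ih = cong suc ih
... | true  | false | ih = ih
... | false | _     | ih = ih

length-filter-∷ : {P : A → Set p} (P? : U.Decidable P) (x : A) (xs : List A) →
  length (filter P? (x ∷ xs)) ≡ length (filter P? (x ∷ [])) + length (filter P? xs)
length-filter-∷ P? x xs with does (P? x)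
... | true  = refl
... | false = refl

filter-cartesianProduct-length : {P : A → Set p} {Q : B → Set q}
  (P? : U.Decidable P) (Q? : U.Decidable Q) (xs : List A) (ys : List B) →
  length (filter (λ z → P? (proj₁ z) ×-dec Q? (proj₂ z)) (cartesianProduct xs ys))
    ≡ length (filter P? xs) * length (filter Q? ys)
filter-cartesianProduct-length P? Q? [] ys = refl
filter-cartesianProduct-length P? Q? (x ∷ xs) ys = begin
  length (filter R? (map (x ,_) ys ++ cartesianProduct xs ys))
    ≡⟨ cong length (filter-++ R? (map (x ,_) ys) (cartesianProduct xs ys)) ⟩
  length (filter R? (map (x ,_) ys) ++ filter R? (cartesianProduct xs ys))
    ≡⟨ length-++ (filter R? (map (x ,_) ys)) ⟩
  length (filter R? (map (x ,_) ys)) + length (filter R? (cartesianProduct xs ys))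
    ≡⟨ cong₂ _+_ (filter-map-length P? Q? x ys) (filter-cartesianProduct-length P? Q? xs ys) ⟩
  l * m + k * m
    ≡⟨ *-distribʳ-+ m l k ⟨
  (l + k) * m
    ≡⟨ cong (_* m) (length-filter-∷ P? x xs) ⟨
  length (filter P? (x ∷ xs)) * m ∎
  where
  open ≡-Reasoning
  R? = λ z → P? (proj₁ z) ×-dec Q? (proj₂ z)
  l = length (filter P? (x ∷ []))
  k = length (filter P? xs)
  m = length (filter Q? ys)

filter-tabulate-length : {P : A → Set p} (P? : U.Decidable P) (f : Fin n → A) →
  length (filter P? (List.tabulate f)) ≡ ∣ tabulate (λ i → does (P? (f i))) ∣
filter-tabulate-length {n = zero}  P? f = refl
filter-tabulate-length {n = suc n} P? f with does (P? (f zero))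
... | true  = cong suc (filter-tabulate-length P? (f ∘ suc))
... | false = filter-tabulate-length P? (f ∘ suc)

tabulate-∈? : (s : Subset n) → tabulate (λ i → does (i ∈? s)) ≡ s
tabulate-∈? []            = refl
tabulate-∈? (inside  ∷ s) = cong (inside ∷_) (tabulate-∈? s)
tabulate-∈? (outside ∷ s) = cong (outside ∷_) (tabulate-∈? s)

filter-∈?-length : (s : Subset n) → length (filter (_∈? s) (allFin n)) ≡ ∣ s ∣
filter-∈?-length s =
  trans (filter-tabulate-length (_∈? s) (λ i → i)) (cong ∣_∣ (tabulate-∈? s))

∣p─q∣+∣p∩q∣ : (s t : Subset n) → ∣ s ─ t ∣ + ∣ s ∩ t ∣ ≡ ∣ s ∣
∣p─q∣+∣p∩q∣ []            []            = refl
∣p─q∣+∣p∩q∣ (inside  ∷ s) (inside  ∷ t) = trans (+-suc _ _) (cong suc (∣p─q∣+∣p∩q∣ s t))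
∣p─q∣+∣p∩q∣ (inside  ∷ s) (outside ∷ t) = cong suc (∣p─q∣+∣p∩q∣ s t)
∣p─q∣+∣p∩q∣ (outside ∷ s) (inside  ∷ t) = ∣p─q∣+∣p∩q∣ s t
∣p─q∣+∣p∩q∣ (outside ∷ s) (outside ∷ t) = ∣p─q∣+∣p∩q∣ s t

∣p─q∣≡∣p∣∸∣p∩q∣ : (s t : Subset n) → ∣ s ─ t ∣ ≡ ∣ s ∣ ∸ ∣ s ∩ t ∣
∣p─q∣≡∣p∣∸∣p∩q∣ s t =
  trans (sym (m+n∸n≡m ∣ s ─ t ∣ ∣ s ∩ t ∣)) (cong (_∸ ∣ s ∩ t ∣) (∣p─q∣+∣p∩q∣ s t))

x∈p─q⇒x∉q : {s t : Subset n} {x : Fin n} → x ∈ s ─ t → x ∉ t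
x∈p─q⇒x∉q {s = inside ∷ s}  {inside ∷ t} () here
x∈p─q⇒x∉q {s = outside ∷ s} {inside ∷ t} () here
x∈p─q⇒x∉q {s = _ ∷ s} {_ ∷ t} (there h) (there h′) = x∈p─q⇒x∉q h h′

module _ (S : SplitGraph n) where
  open SplitGraph S

  Adj⇒∈N : ∀ {u v} → Adj u v → v ∈ N u
  Adj⇒∈N {u} {v} uv =
    lookup⇒[]= v (N u) (trans (lookup∘tabulate _ v) (dec-true (adj? u v) uv))

  ∈N⇒Adj : ∀ {u v} → v ∈ N u → Adj u v
  ∈N⇒Adj {u} {v} v∈N with adj? u v | trans (sym (lookup∘tabulate (λ w → does (adj? u w)) v)) ([]=⇒lookup v∈N)
  ... | yes uv | _  = uv
  ... | no  _  | ()

  adj-I⇒K : ∀ {u v} → u ∈ I → Adj u v → v ∈ K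
  adj-I⇒K {u} {v} u∈I uv with cover v
  ... | inj₁ v∈K = v∈K
  ... | inj₂ v∈I = contradiction uv (independent u∈I v∈I)

  Private : Fin n → Fin n → Fin n × Fin n × Fin n → Set
  Private u v (b , c , e) = b ∈ N u ─ N v × c ∈ N v ─ N u × e ∈ ⁅ v ⁆

  actsOn⇒private : ∀ {u v} → u ∈ I → v ∈ I → ∀ {t} → ActsOn u v t → Private u v t
  actsOn⇒private u∈I v∈I ((_ , ub , _) , here refl) = contradiction ub (independent u∈I v∈I)
  actsOn⇒private u∈I v∈I ((_ ∷ (_ ∷ b≢e ∷ []) ∷ _ , ub , ve , _ , ¬be) , there (here refl)) =
    contradiction (clique (adj-I⇒K u∈I ub) (adj-I⇒K v∈I ve) b≢e) ¬be
  actsOn⇒private {v = v} u∈I v∈I ((_ , ub , ce , ¬uc , ¬be) , there (there (here refl))) =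
    x∈p∧x∉q⇒x∈p─q (Adj⇒∈N ub) (¬be ∘ adj-sym ∘ ∈N⇒Adj) ,
    x∈p∧x∉q⇒x∈p─q (Adj⇒∈N (adj-sym ce)) (¬uc ∘ ∈N⇒Adj) ,
    x∈⁅x⁆ v

  private⇒actsOn : ∀ {u v} → u ∈ I → v ∈ I → ∀ {t} → Private u v t → ActsOn u v t
  private⇒actsOn {u} {v} u∈I v∈I {b , c , e} (b∈ , c∈ , e∈) with x∈⁅y⁆⇒x≡y v e∈
  ... | refl =
    ( ( ((λ { refl → irrefl _ ub }) ∷ (λ { refl → independent v∈I u∈I vc }) ∷ (λ { refl → ¬vb ub }) ∷ [])
      ∷ ((λ { refl → ¬uc ub }) ∷ (λ { refl → independent u∈I v∈I ub }) ∷ [])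
      ∷ ((λ { refl → irrefl _ vc }) ∷ [])
      ∷ [] ∷ [])
    , ub , adj-sym vc , ¬uc , ¬vb ∘ adj-sym )
    , there (there (here refl))
    where
    ub  = ∈N⇒Adj (p─q⊆p (N u) (N v) b∈)
    vc  = ∈N⇒Adj (p─q⊆p (N v) (N u) c∈)
    ¬vb : ¬ Adj v b
    ¬vb = x∈p─q⇒x∉q b∈ ∘ Adj⇒∈N
    ¬uc : ¬ Adj u c
    ¬uc = x∈p─q⇒x∉q c∈ ∘ Adj⇒∈N

  length-twoSwitches : ∀ {u v} → u ∈ I → v ∈ I → length (twoSwitches u v) ≡ σ u v
  length-twoSwitches {u} {v} u∈I v∈I = begin
    length (twoSwitches u v)
      ≡⟨ cong length (filter-≐ (actsOn? u v) private?
           (actsOn⇒private u∈I v∈I , private⇒actsOn u∈I v∈I) triples) ⟩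
    length (filter private? triples)
      ≡⟨ filter-cartesianProduct-length (_∈? N u ─ N v) rest? (allFin n) pairs ⟩
    length (filter (_∈? N u ─ N v) (allFin n)) * length (filter rest? pairs)
      ≡⟨ cong₂ _*_ (filter-∈?-length (N u ─ N v))
           (filter-cartesianProduct-length (_∈? N v ─ N u) (_∈? ⁅ v ⁆) (allFin n) (allFin n)) ⟩
    ∣ N u ─ N v ∣ * (length (filter (_∈? N v ─ N u) (allFin n)) * length (filter (_∈? ⁅ v ⁆) (allFin n)))
      ≡⟨ cong (∣ N u ─ N v ∣ *_) (cong₂ _*_ (filter-∈?-length (N v ─ N u))
           (trans (filter-∈?-length ⁅ v ⁆) (∣⁅x⁆∣≡1 v))) ⟩
    ∣ N u ─ N v ∣ * (∣ N v ─ N u ∣ * 1)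
      ≡⟨ cong (∣ N u ─ N v ∣ *_) (*-identityʳ _) ⟩
    ∣ N u ─ N v ∣ * ∣ N v ─ N u ∣
      ≡⟨ cong₂ _*_ (∣p─q∣≡∣p∣∸∣p∩q∣ (N u) (N v))
           (trans (∣p─q∣≡∣p∣∸∣p∩q∣ (N v) (N u)) (cong (λ s → d v ∸ ∣ s ∣) (∩-comm (N v) (N u)))) ⟩
    σ u v ∎
    where
    open ≡-Reasoning
    pairs   = cartesianProduct (allFin n) (allFin n)
    triples = cartesianProduct (allFin n) pairs
    rest? : U.Decidable (λ (z : Fin n × Fin n) → proj₁ z ∈ N v ─ N u × proj₂ z ∈ ⁅ v ⁆)
    rest? z = (proj₁ z ∈? N v ─ N u) ×-dec (proj₂ z ∈? ⁅ v ⁆)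
    private? : U.Decidable (Private u v)
    private? z = (proj₁ z ∈? N u ─ N v) ×-dec rest? (proj₂ z)

  σ-sym : ∀ u v → σ u v ≡ σ v u
  σ-sym u v = trans (*-comm (d u ∸ η u v) (d v ∸ η u v))
    (cong (λ s → (d v ∸ ∣ s ∣) * (d u ∸ ∣ s ∣)) (∩-comm (N u) (N v)))

  σ-diag : ∀ v → σ v v ≡ 0
  σ-diag v = cong (_* (d v ∸ η v v))
    (trans (cong (λ s → d v ∸ ∣ s ∣) (∩-idem (N v))) (n∸n≡0 (d v)))

Φ : SplitGraph n → Multigraph
Φ S = record
  { Vertex       = ∃ (_∈ I)
  ; multiplicity = λ u v → length (twoSwitches (proj₁ u) (proj₁ v))
  ; mult-sym     = λ (u , u∈I) (v , v∈I) →
      trans (length-twoSwitches S u∈I v∈I) (trans (σ-sym S u v) (sym (length-twoSwitches S v∈I u∈I)))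
  ; loopless     = λ (v , v∈I) → trans (length-twoSwitches S v∈I v∈I) (σ-diag S v)
  }
  where open SplitGraph S

{-# OPTIONS --safe #-}
module Submission where

-- Vertices u, v are adjacent in Φ(S) iff N u and N v are incomparable under
-- inclusion.  Write A, B, C, D for the neighborhoods along the path;
-- σ₂₃ = 1 makes B ─ C and C ─ B singletons.
-- If A ⊆ C, then A ⊆ D (as D ⊈ C), and the element of A ─ B, which is the one
-- of C ─ B, lies in D, so D ⊈ B; hence B ⊆ D and C ⊆ D, a contradiction.
-- If C ⊆ A, then D ⊆ A (as C ⊈ D), and the element of B ─ A, which is the one
-- of B ─ C, is not in D, so B ⊈ D; hence D ⊆ B and D ⊆ C, a contradiction.

open import Defs
open import Data.Fin.Base using (Fin; zero; suc)
open import Data.Fin.Properties using (_≟_)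
open import Data.Fin.Subset using (Subset; _∈_; _⊆_; _─_; ∣_∣; ⁅_⁆; Nonempty)
open import Data.Fin.Subset.Properties using (_∈?_; nonempty?; Empty-unique; ∣⊥∣≡0; ∣⁅x⁆∣≡1; x∈⁅y⁆⇒x≡y; p⊆q⇒∣p∣≤∣q∣; p⊂q⇒∣p∣<∣q∣; p─q⊆p; x∈p∧x∉q⇒x∈p─q; ∩-comm)
open import Data.Nat.Base using (ℕ; _*_; _∸_; _≤_; _<_; z<s; s<s; >-nonZero; >-nonZero⁻¹)
open import Data.Nat.Properties using (m*n≡0⇒m≡0∨n≡0; m*n≡1⇒m≡1; m*n≡1⇒n≡1; m*n≢0⇒m≢0; m*n≢0⇒n≢0; ≮⇒≥; n≤0⇒n≡0; <-irrefl)
open import Data.Product.Base using (_×_; _,_; ∃-syntax; proj₁)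
open import Data.Sum.Base using (_⊎_; inj₁; inj₂)
import Data.Sum.Base as Sum
open import Data.Vec.Base using (_∷_; [])
open import Relation.Binary.PropositionalEquality using (_≡_; refl; sym; trans; cong; cong₂; subst; subst₂)
open import Relation.Nullary using (¬_; yes; no; contradiction)

private
  variable
    n : ℕ
    p q : Subset n

0<∣p∣⇒nonempty : 0 < ∣ p ∣ → Nonempty p
0<∣p∣⇒nonempty {n} {p} 0<∣p∣ with nonempty? p
... | yes ne    = ne
... | no  empty =
  contradiction 0<∣p∣ (<-irrefl (sym (trans (cong ∣_∣ (Empty-unique empty)) (∣⊥∣≡0 n))))

⁅x⁆⊆p : {x : Fin n} → x ∈ p → ⁅ x ⁆ ⊆ p
⁅x⁆⊆p {p = p} {x} x∈p y∈⁅x⁆ = subst (_∈ p) (sym (x∈⁅y⁆⇒x≡y x y∈⁅x⁆)) x∈p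

-- If `y ≢ x`, then `⁅ x ⁆` is a proper subset of `p`, which forces `1 < ∣ p ∣`.
∣p∣≡1⇒unique : {x y : Fin n} → ∣ p ∣ ≡ 1 → x ∈ p → y ∈ p → x ≡ y
∣p∣≡1⇒unique {x = x} {y} ∣p∣≡1 x∈p y∈p with y ≟ x
... | yes y≡x = sym y≡x
... | no  y≢x = contradiction
  (p⊂q⇒∣p∣<∣q∣ (⁅x⁆⊆p x∈p , y , y∈p , λ y∈⁅x⁆ → y≢x (x∈⁅y⁆⇒x≡y x y∈⁅x⁆)))
  (<-irrefl (trans (∣⁅x⁆∣≡1 x) (sym ∣p∣≡1)))

∣p─q∣≡0⇒p⊆q : ∣ p ─ q ∣ ≡ 0 → p ⊆ q
∣p─q∣≡0⇒p⊆q {p = p} {q} ∣p─q∣≡0 {x} x∈p with x ∈? q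
... | yes x∈q = x∈q
... | no  x∉q = contradiction
  (subst₂ _≤_ (∣⁅x⁆∣≡1 x) ∣p─q∣≡0 (p⊆q⇒∣p∣≤∣q∣ (⁅x⁆⊆p (x∈p∧x∉q⇒x∈p─q x∈p x∉q))))
  λ ()

-- The path conditions for arbitrary sets: the three disjunctions are the missing chords 13, 14 and
-- 24. Two of the eight sign patterns use the singleton hypotheses; the others fail by chaining
-- inclusions.
no-incomparable-chain : {A B C D : Subset n} →
  Nonempty (A ─ B) → Nonempty (B ─ A) → Nonempty (C ─ D) → Nonempty (D ─ C) →
  ∣ B ─ C ∣ ≡ 1 → ∣ C ─ B ∣ ≡ 1 →
  A ⊆ C ⊎ C ⊆ A → A ⊆ D ⊎ D ⊆ A → ¬ (B ⊆ D ⊎ D ⊆ B)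
no-incomparable-chain {A = A} {B} {C} {D} (a , a∈A─B) (b , b∈B─A) (c , c∈C─D) (e , e∈D─C) ∣B─C∣≡1 ∣C─B∣≡1 = λ
  -- Both `a` and `c` lie in `C ─ B`, so they coincide, but only `a` is in `D`.
  { (inj₁ A⊆C) (inj₁ A⊆D) (inj₁ B⊆D) → c∉D (subst (_∈ D)
      (∣p∣≡1⇒unique ∣C─B∣≡1 (x∈p∧x∉q⇒x∈p─q (A⊆C a∈A) a∉B) (x∈p∧x∉q⇒x∈p─q c∈C λ c∈B → c∉D (B⊆D c∈B)))
      (A⊆D a∈A))
  ; (inj₁ A⊆C) (inj₁ A⊆D) (inj₂ D⊆B) → a∉B (D⊆B (A⊆D a∈A))
  ; (inj₁ A⊆C) (inj₂ D⊆A) _          → e∉C (A⊆C (D⊆A e∈D))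
  ; (inj₂ C⊆A) (inj₁ A⊆D) _          → c∉D (A⊆D (C⊆A c∈C))
  ; (inj₂ C⊆A) (inj₂ D⊆A) (inj₁ B⊆D) → b∉A (D⊆A (B⊆D b∈B))
  -- Both `e` and `b` lie in `B ─ C`, so they coincide, but only `e` is in `A`.
  ; (inj₂ C⊆A) (inj₂ D⊆A) (inj₂ D⊆B) → b∉A (subst (_∈ A)
      (∣p∣≡1⇒unique ∣B─C∣≡1 (x∈p∧x∉q⇒x∈p─q (D⊆B e∈D) e∉C) (x∈p∧x∉q⇒x∈p─q b∈B λ b∈C → b∉A (C⊆A b∈C)))
      (D⊆A e∈D))
  }
  where
  a∈A = p─q⊆p A B a∈A─B
  a∉B = x∈p─q⇒x∉q a∈A─B
  b∈B = p─q⊆p B A b∈B─A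
  b∉A = x∈p─q⇒x∉q b∈B─A
  c∈C = p─q⊆p C D c∈C─D
  c∉D = x∈p─q⇒x∉q c∈C─D
  e∈D = p─q⊆p D C e∈D─C
  e∉C = x∈p─q⇒x∉q e∈D─C

module _ (S : SplitGraph n) where
  open SplitGraph S
  open Multigraph (Φ S)

  σ≡∣N─N∣*∣N─N∣ : ∀ u v → σ u v ≡ ∣ N u ─ N v ∣ * ∣ N v ─ N u ∣
  σ≡∣N─N∣*∣N─N∣ u v = sym (cong₂ _*_ (∣p─q∣≡∣p∣∸∣p∩q∣ (N u) (N v))
    (trans (∣p─q∣≡∣p∣∸∣p∩q∣ (N v) (N u)) (cong (λ s → d v ∸ ∣ s ∣) (∩-comm (N v) (N u)))))

  multiplicity≡∣N─N∣*∣N─N∣ : ∀ ((u , u∈I) (v , v∈I) : Vertex) →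
    multiplicity (u , u∈I) (v , v∈I) ≡ ∣ N u ─ N v ∣ * ∣ N v ─ N u ∣
  multiplicity≡∣N─N∣*∣N─N∣ (u , u∈I) (v , v∈I) =
    trans (length-twoSwitches S u∈I v∈I) (σ≡∣N─N∣*∣N─N∣ u v)

  adjacent⇒incomparable : ∀ ((u , u∈I) (v , v∈I) : Vertex) → Adjacent (u , u∈I) (v , v∈I) →
    Nonempty (N u ─ N v) × Nonempty (N v ─ N u)
  adjacent⇒incomparable (u , u∈I) (v , v∈I) uv =
    0<∣p∣⇒nonempty (>-nonZero⁻¹ _ {{m*n≢0⇒m≢0 ∣ N u ─ N v ∣ {{prod}}}}) ,
    0<∣p∣⇒nonempty (>-nonZero⁻¹ _ {{m*n≢0⇒n≢0 ∣ N u ─ N v ∣ {{prod}}}})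
    where prod = >-nonZero (subst (0 <_) (multiplicity≡∣N─N∣*∣N─N∣ (u , u∈I) (v , v∈I)) uv)

  -- Multiplicity 0 makes one factor of the product vanish, so one of the two differences is empty.
  ¬adjacent⇒comparable : ∀ ((u , u∈I) (v , v∈I) : Vertex) → ¬ Adjacent (u , u∈I) (v , v∈I) →
    N u ⊆ N v ⊎ N v ⊆ N u
  ¬adjacent⇒comparable (u , u∈I) (v , v∈I) ¬uv =
    Sum.map ∣p─q∣≡0⇒p⊆q ∣p─q∣≡0⇒p⊆q (m*n≡0⇒m≡0∨n≡0 ∣ N u ─ N v ∣
      (trans (sym (multiplicity≡∣N─N∣*∣N─N∣ (u , u∈I) (v , v∈I))) (n≤0⇒n≡0 (≮⇒≥ ¬uv))))

theorem4p1 : ∀ {n : ℕ} (S : SplitGraph n) →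
    ¬ (∃[ v₁ ] ∃[ v₂ ] ∃[ v₃ ] ∃[ v₄ ]
    (IsInducedPath (Φ S) (v₁ ∷ v₂ ∷ v₃ ∷ v₄ ∷ []) ×
    SplitGraph.σ S (proj₁ v₂) (proj₁ v₃) ≡ 1))
theorem4p1 S (v₁ , v₂ , v₃ , v₄ , path , σ₂₃≡1)
  with adjacent⇒incomparable S v₁ v₂ (IsInducedPath.consecutive path zero (suc zero) refl)
     | adjacent⇒incomparable S v₃ v₄ (IsInducedPath.consecutive path (suc (suc zero)) (suc (suc (suc zero))) refl)
... | N₁⊈N₂ , N₂⊈N₁ | N₃⊈N₄ , N₄⊈N₃ =
  no-incomparable-chain N₁⊈N₂ N₂⊈N₁ N₃⊈N₄ N₄⊈N₃
    -- A product of naturals is 1 only if both factors are, so both differences are singletons.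
    (m*n≡1⇒m≡1 ∣ N₂ ─ N₃ ∣ ∣ N₃ ─ N₂ ∣ product≡1)
    (m*n≡1⇒n≡1 ∣ N₂ ─ N₃ ∣ ∣ N₃ ─ N₂ ∣ product≡1)
    (¬adjacent⇒comparable S v₁ v₃ (chordless zero (suc (suc zero)) (s<s z<s)))
    (¬adjacent⇒comparable S v₁ v₄ (chordless zero (suc (suc (suc zero))) (s<s z<s)))
    (¬adjacent⇒comparable S v₂ v₄ (chordless (suc zero) (suc (suc (suc zero))) (s<s (s<s z<s))))
  where
  open IsInducedPath path
  N₂ = SplitGraph.N S (proj₁ v₂)
  N₃ = SplitGraph.N S (proj₁ v₃)
  product≡1 = trans (sym (σ≡∣N─N∣*∣N─N∣ S (proj₁ v₂) (proj₁ v₃))) σ₂₃≡1
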